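{- Let $G$ be a non-supergraceful graph with $p$ nodes and $q$ edges having a node $u$ of degree $p-1$. Suppose there is a semitotal labeling $\varphi$ of $G$ such that $\varphi(u) = \mathrm{opt}(G)$ and $\mathrm{opt}(G)-1 \in N(\varphi) \cup E(\varphi)$, where $\mathrm{opt}(G) = p+q+q_0$. Then there is a semitotal labeling $\mu$ of $G$ such that $1 \in N(\mu)$.
   Context: Graphs are finite, simple, connected. For a labeling $\varphi: V(G) \to \mathbb{Z}_{>0}$ let $N(\varphi) = \{\varphi(x) : x \in V(G)\}$ and $E(\varphi) = \{|\varphi(x)-\varphi(y)| : xy \in E(G)\}$. A total labeling of a $(p,q)$-graph $G$ is a map $\varphi$ such that the $p$ node labels and the $q$ edge labels are pairwise distinct and $N(\varphi) \cup E(\varphi) = \{1,\dots,p+q\}$; $G$ is supergraceful if it has one, non-supergraceful otherwise. If $G$ is non-supergraceful, let $q_0 > 0$ be the least integer such that there is a labeling $\varphi$ with all $p$ node labels and $q$ edge labels pairwise distinct and $N(\varphi) \cup E(\varphi) \subseteq \{1,2,\dots,p+q+q_0\}$; such a $\varphi$ is a semitotal labeling, and $\mathrm{opt}(G) := p+q+q_0$. -}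

module Defs where

open import Level using (0ℓ)
open import Data.Nat using (ℕ; _+_; _≤_; _>_; ∣_-_∣)
open import Data.Fin using (Fin; _<_)
open import Data.Fin.Properties using (_<?_)
open import Data.List using (List; length; filter; allFin; cartesianProduct)
open import Data.Product using (∃; ∃-syntax; _×_; _,_)
open import Data.Sum using (_⊎_)
open import Function.Definitions using (Injective)
open import Relation.Binary using (Rel; Decidable; Symmetric)
open import Relation.Binary.Construct.Closure.ReflexiveTransitive using (Star)
open import Relation.Binary.PropositionalEquality using (_≡_; _≢_)
open import Relation.Nullary using (¬_)
open import Relation.Nullary.Decidable using (_×-dec_)
open import Relation.Unary using (Pred; _∪_; _⊆_; _≐_)

-- A finite simple connected graph with node set Fin p.
record Graph (p : ℕ) : Set₁ where
  field
    _~_       : Rel (Fin p) 0ℓ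
    _~?_      : Decidable _~_
    ~-sym     : Symmetric _~_
    ~-irrefl  : ∀ x → ¬ (x ~ x)
    connected : ∀ x y → Star _~_ x y

  -- Each edge is listed once, with its smaller endpoint first.
  edges : List (Fin p × Fin p)
  edges = filter (λ (x , y) → (x <? y) ×-dec (x ~? y))
                 (cartesianProduct (allFin p) (allFin p))

  size : ℕ
  size = length edges

  degree : Fin p → ℕ
  degree x = length (filter (x ~?_) (allFin p))

record Labeling (p : ℕ) : Set where
  field
    label    : Fin p → ℕ
    positive : ∀ x → label x > 0

open Labeling public

[1⋯_] : ℕ → Pred ℕ 0ℓ
[1⋯ m ] k = 1 ≤ k × k ≤ m

N : ∀ {p} → Labeling p → Pred ℕ 0ℓ
N φ k = ∃[ x ] label φ x ≡ k

module _ {p : ℕ} (G : Graph p) where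
  open Graph G

  E : Labeling p → Pred ℕ 0ℓ
  E φ k = ∃[ x ] ∃[ y ] x ~ y × ∣ label φ x - label φ y ∣ ≡ k

  -- The p node labels together with the q edge labels are pairwise distinct.
  -- Edges are presented here by ordered pairs of endpoints, so (x , y) and
  -- (y , x) are the same edge.
  record Distinct (φ : Labeling p) : Set where
    field
      nodes≢nodes : Injective _≡_ _≡_ (label φ)
      edges≢edges : ∀ {x y x′ y′} → x ~ y → x′ ~ y′ →
                    ∣ label φ x - label φ y ∣ ≡ ∣ label φ x′ - label φ y′ ∣ →
                    (x ≡ x′ × y ≡ y′) ⊎ (x ≡ y′ × y ≡ x′)
      nodes≢edges : ∀ {x y z} → x ~ y →
                    label φ z ≢ ∣ label φ x - label φ y ∣

  IsTotal : Labeling p → Set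
  IsTotal φ = Distinct φ × (N φ ∪ E φ) ≐ [1⋯ p + size ]

  Supergraceful : Set
  Supergraceful = ∃ IsTotal

  FitsWithExcess : ℕ → Labeling p → Set
  FitsWithExcess k φ = Distinct φ × (N φ ∪ E φ) ⊆ [1⋯ p + size + k ]

  -- q₀ is the least positive integer k for which some labeling fits in
  -- {1, …, p + q + k}; opt(G) is then p + size + q₀.
  record IsLeastExcess (q₀ : ℕ) : Set where
    field
      pos      : q₀ > 0
      attained : ∃ (FitsWithExcess q₀)
      least    : ∀ k → k > 0 → ∃ (FitsWithExcess k) → q₀ ≤ k

  IsOpt : ℕ → Set
  IsOpt m = ∃[ q₀ ] IsLeastExcess q₀ × m ≡ p + size + q₀

  -- Used only for graphs that are not supergraceful.
  IsSemitotal : Labeling p → Set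
  IsSemitotal φ = ∃[ q₀ ] IsLeastExcess q₀ × FitsWithExcess q₀ φ

{-# OPTIONS --safe #-}

-- Write M = opt(G) = φ(u). If M − 1 is an edge label then, all labels lying in
-- {1, …, M}, the endpoints of that edge are labelled 1 and M, so μ = φ works.
-- If M − 1 is a node label, replace φ(z) by M − φ(z) at every node z ≠ u. As u is
-- adjacent to all other nodes, this only exchanges the label of each z ≠ u with
-- the label of the edge uz, and so the set of all labels is unchanged. The node
-- labelled M − 1 becomes labelled 1.
module Submission where

open import Defs
open import Data.Nat using (ℕ; zero; suc; _+_; _∸_; _≤_; _>_; ∣_-_∣; z≤n; s≤s)
open import Data.Nat.Properties
open import Data.Fin using (Fin)
import Data.Fin as Fin
open import Data.List using (List; []; _∷_; length; filter; allFin)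
open import Data.List.Properties using (length-tabulate)
import Data.List.Membership.Propositional as List
open import Data.List.Membership.Propositional.Properties using (∈-filter⁺; ∈-allFin)
open import Data.List.Relation.Ternary.Interleaving.Properties using (interleave-length)
open import Data.List.Relation.Ternary.Interleaving.Propositional.Properties using (filter⁺)
open import Data.List.Relation.Unary.Any using (here)
open import Data.Product using (∃-syntax; _×_; _,_; proj₁; proj₂)
open import Data.Sum using (_⊎_; inj₁; inj₂)
open import Function using (_∘_; id)
open import Function.Definitions using (Injective)
open import Relation.Binary.PropositionalEquality
  using (_≡_; _≢_; refl; sym; trans; cong; cong₂; ≢-sym; module ≡-Reasoning)
open import Relation.Nullary using (¬_; yes; no; contradiction)
open import Relation.Nullary.Decidable using (¬?; decidable-stable)
open import Relation.Unary using (_∈_; _∪_; _⊆_)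

∣m-n∣>0 : ∀ {m n} → m ≢ n → ∣ m - n ∣ > 0
∣m-n∣>0 m≢n = n≢0⇒n>0 (m≢n ∘ ∣m-n∣≡0⇒m≡n)

∣m-∣m-n∣∣≡n : ∀ {m n} → n ≤ m → ∣ m - ∣ m - n ∣ ∣ ≡ n
∣m-∣m-n∣∣≡n {m} {n} n≤m = begin
  ∣ m - ∣ m - n ∣ ∣ ≡⟨ cong ∣ m -_∣ (m≤n⇒∣n-m∣≡n∸m n≤m) ⟩
  ∣ m - m ∸ n ∣     ≡⟨ m≤n⇒∣n-m∣≡n∸m (m∸n≤m m n) ⟩
  m ∸ (m ∸ n)       ≡⟨ m∸[m∸n]≡n n≤m ⟩
  n                 ∎
  where open ≡-Reasoning

-- Reflection `t ↦ m - t` is an isometry on numbers up to `m`. This is what leaves the labels of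
-- edges avoiding `u` unchanged.
∣∣m-a∣-∣m-b∣∣≡∣a-b∣ : ∀ {m a b} → a ≤ m → b ≤ m →
                      ∣ ∣ m - a ∣ - ∣ m - b ∣ ∣ ≡ ∣ a - b ∣
∣∣m-a∣-∣m-b∣∣≡∣a-b∣ {m} {a} {b} a≤m b≤m = begin
  ∣ ∣ m - a ∣ - ∣ m - b ∣ ∣                   ≡⟨ cong₂ ∣_-_∣ (m≤n⇒∣n-m∣≡n∸m a≤m) (m≤n⇒∣n-m∣≡n∸m b≤m) ⟩
  -- Shifting both terms by `a + b` clears the truncated subtractions.
  ∣ m ∸ a - m ∸ b ∣                           ≡⟨ ∣m+n-m+o∣≡∣n-o∣ (a + b) (m ∸ a) (m ∸ b) ⟨
  ∣ a + b + (m ∸ a) - a + b + (m ∸ b) ∣       ≡⟨ cong₂ ∣_-_∣ left right ⟩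
  ∣ m + b - m + a ∣                           ≡⟨ ∣m+n-m+o∣≡∣n-o∣ m b a ⟩
  ∣ b - a ∣                                   ≡⟨ ∣-∣-comm b a ⟩
  ∣ a - b ∣                                   ∎
  where
  open ≡-Reasoning
  right : a + b + (m ∸ b) ≡ m + a
  right = begin
    a + b + (m ∸ b)   ≡⟨ +-assoc a b (m ∸ b) ⟩
    a + (b + (m ∸ b)) ≡⟨ cong (a +_) (m+[n∸m]≡n b≤m) ⟩
    a + m             ≡⟨ +-comm a m ⟩
    m + a             ∎
  left : a + b + (m ∸ a) ≡ m + b
  left = begin
    a + b + (m ∸ a)   ≡⟨ cong (_+ (m ∸ a)) (+-comm a b) ⟩
    b + a + (m ∸ a)   ≡⟨ +-assoc b a (m ∸ a) ⟩
    b + (a + (m ∸ a)) ≡⟨ cong (b +_) (m+[n∸m]≡n a≤m) ⟩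
    b + m             ≡⟨ +-comm b m ⟩
    m + b             ∎

-- Two numbers in `{2, …, m}` differ by at most `m - 2`, so a difference of `m - 1` forces one of
-- them down to 1.
extreme-difference : ∀ {a b m} → 1 ≤ a → 1 ≤ b → a ≤ m → b ≤ m →
                     ∣ a - b ∣ ≡ m ∸ 1 → a ≡ 1 ⊎ b ≡ 1
extreme-difference {suc zero}    {suc b}       _ _ _ _ _ = inj₁ refl
extreme-difference {suc (suc a)} {suc zero}    _ _ _ _ _ = inj₂ refl
extreme-difference {suc (suc a)} {suc (suc b)} {suc m} _ _ (s≤s a<m) (s≤s b<m) eq =
  contradiction eq (<⇒≢ (≤-<-trans (∣m-n∣≤m⊔n a b) (⊔-lub a<m b<m)))

length≡1⇒∈-unique : ∀ {A : Set} {xs : List A} {x y} → length xs ≡ 1 →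
                    x List.∈ xs → y List.∈ xs → x ≡ y
length≡1⇒∈-unique {xs = _ ∷ []} _ (here x≡z) (here y≡z) = trans x≡z (sym y≡z)

module _ {p : ℕ} (G : Graph p) where
  open Graph G

  Universal : Fin p → Set
  Universal u = ∀ {x} → x ≢ u → u ~ x

  -- The non-neighbours of u, including u itself, form a list of length one.
  degree≡p∸1⇒universal : ∀ u → degree u ≡ p ∸ 1 → Universal u
  degree≡p∸1⇒universal u deg {x} x≢u = decidable-stable (u ~? x) λ u≁x →
    x≢u (length≡1⇒∈-unique one (nonNeighbour u≁x) (nonNeighbour (~-irrefl u)))
    where
    nonNeighbours : List (Fin p)
    nonNeighbours = filter (¬? ∘ (u ~?_)) (allFin p)

    nonNeighbour : ∀ {y} → ¬ (u ~ y) → y List.∈ nonNeighbours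
    nonNeighbour = ∈-filter⁺ (¬? ∘ (u ~?_)) (∈-allFin _)

    1≤p : ∀ {n} → Fin n → 1 ≤ n
    1≤p {suc _} _ = s≤s z≤n

    one : length nonNeighbours ≡ 1
    one = +-cancelˡ-≡ (p ∸ 1) _ _ (begin
      p ∸ 1 + length nonNeighbours    ≡⟨ cong (_+ length nonNeighbours) deg ⟨
      -- Neighbours and non-neighbours interleave to the list of all nodes.
      degree u + length nonNeighbours ≡⟨ interleave-length (filter⁺ (u ~?_) (allFin p)) ⟨
      length (allFin p)               ≡⟨ length-tabulate id ⟩
      p                               ≡⟨ m∸n+n≡m (1≤p u) ⟨
      p ∸ 1 + 1                       ∎)
      where open ≡-Reasoning

  ~⇒≢ : ∀ {x y} → x ~ y → x ≢ y
  ~⇒≢ x~x refl = ~-irrefl _ x~x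

  module Complement (φ : Labeling p) (distinct : Distinct G φ) (u : Fin p)
                    (universal : Universal u)
                    (maximal : ∀ x → label φ x ≤ label φ u) where
    open Distinct distinct

    -- With `∣_-_∣` in place of `∸`, the new label of `z ≢ u` is literally the `φ`-label of the edge
    -- from `u` to `z`, so the fields of `distinct` apply to it directly.
    complementLabel : Fin p → ℕ
    complementLabel z with z Fin.≟ u
    ... | yes _ = label φ u
    ... | no  _ = ∣ label φ u - label φ z ∣

    complement-centre : complementLabel u ≡ label φ u
    complement-centre with u Fin.≟ u
    ... | yes _   = refl
    ... | no  u≢u = contradiction refl u≢u

    complement-other : ∀ {z} → z ≢ u → complementLabel z ≡ ∣ label φ u - label φ z ∣
    complement-other {z} z≢u with z Fin.≟ u
    ... | yes z≡u = contradiction z≡u z≢u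
    ... | no  _   = refl

    complement : Labeling p
    complement .label      = complementLabel
    complement .positive z with z Fin.≟ u
    ... | yes _   = positive φ u
    ... | no  z≢u = ∣m-n∣>0 (≢-sym z≢u ∘ nodes≢nodes)

    difference : Fin p → Fin p → ℕ
    difference x y = ∣ complementLabel x - complementLabel y ∣

    difference-centre : ∀ {z} → z ≢ u → difference u z ≡ label φ z
    difference-centre {z} z≢u =
      trans (cong₂ ∣_-_∣ complement-centre (complement-other z≢u)) (∣m-∣m-n∣∣≡n (maximal z))

    -- Each case names the `φ`-label that the edge now carries: a spoke takes a node label, a rim
    -- edge keeps its own. Collisions of new labels thus pull back to collisions under `φ`.
    data EdgeLabel (x y : Fin p) : Set where
      spokeˡ : x ≡ u → difference x y ≡ label φ y → EdgeLabel x y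
      spokeʳ : y ≡ u → difference x y ≡ label φ x → EdgeLabel x y
      rim    : x ≢ u → y ≢ u → difference x y ≡ ∣ label φ x - label φ y ∣ → EdgeLabel x y

    edgeLabel : ∀ {x y} → x ~ y → EdgeLabel x y
    edgeLabel {x} {y} x~y with x Fin.≟ u | y Fin.≟ u
    ... | yes refl | _        = spokeˡ refl (difference-centre (≢-sym (~⇒≢ x~y)))
    ... | no x≢u   | yes refl = spokeʳ refl (trans (∣-∣-comm (complementLabel x) (complementLabel u)) (difference-centre x≢u))
    ... | no x≢u   | no y≢u   = rim x≢u y≢u
      (trans (cong₂ ∣_-_∣ (complement-other x≢u) (complement-other y≢u))
             (∣∣m-a∣-∣m-b∣∣≡∣a-b∣ (maximal x) (maximal y)))

    complement-injective : Injective _≡_ _≡_ complementLabel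
    complement-injective {x} {y} eq with x Fin.≟ u | y Fin.≟ u
    ... | yes x≡u | yes y≡u = trans x≡u (sym y≡u)
    ... | yes _   | no y≢u  = contradiction eq (nodes≢edges (universal y≢u))
    ... | no x≢u  | yes _   = contradiction (sym eq) (nodes≢edges (universal x≢u))
    ... | no x≢u  | no y≢u  with edges≢edges (universal x≢u) (universal y≢u) eq
    ...   | inj₁ (_ , x≡y) = x≡y
    -- The edges from `u` to `x` and to `y` could match crosswise only if `x` were `u`.
    ...   | inj₂ (_ , x≡u) = contradiction x≡u x≢u

    -- Two spokes with equal labels have the same outer end by injectivity of `φ`. A spoke against a
    -- rim edge is a node against an edge under `φ`, and two rim edges are compared as before.
    complement-edges : ∀ {x y x′ y′} → x ~ y → x′ ~ y′ → difference x y ≡ difference x′ y′ →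
                       (x ≡ x′ × y ≡ y′) ⊎ (x ≡ y′ × y ≡ x′)
    complement-edges x~y x′~y′ eq with edgeLabel x~y | edgeLabel x′~y′
    ... | spokeˡ x≡u d | spokeˡ x′≡u d′ =
      inj₁ (trans x≡u (sym x′≡u) , nodes≢nodes (trans (sym d) (trans eq d′)))
    ... | spokeˡ x≡u d | spokeʳ y′≡u d′ =
      inj₂ (trans x≡u (sym y′≡u) , nodes≢nodes (trans (sym d) (trans eq d′)))
    ... | spokeʳ y≡u d | spokeˡ x′≡u d′ =
      inj₂ (nodes≢nodes (trans (sym d) (trans eq d′)) , trans y≡u (sym x′≡u))
    ... | spokeʳ y≡u d | spokeʳ y′≡u d′ =
      inj₁ (nodes≢nodes (trans (sym d) (trans eq d′)) , trans y≡u (sym y′≡u))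
    ... | spokeˡ _ d   | rim _ _ d′     = contradiction (trans (sym d) (trans eq d′)) (nodes≢edges x′~y′)
    ... | spokeʳ _ d   | rim _ _ d′     = contradiction (trans (sym d) (trans eq d′)) (nodes≢edges x′~y′)
    ... | rim _ _ d    | spokeˡ _ d′    = contradiction (trans (sym d′) (trans (sym eq) d)) (nodes≢edges x~y)
    ... | rim _ _ d    | spokeʳ _ d′    = contradiction (trans (sym d′) (trans (sym eq) d)) (nodes≢edges x~y)
    ... | rim _ _ d    | rim _ _ d′     = edges≢edges x~y x′~y′ (trans (sym d) (trans eq d′))

    -- Here `label φ w` plays the role of the new label of the edge from `u` to `w`.
    spoke≢node : ∀ {w z} → w ≢ u → complementLabel z ≢ label φ w
    spoke≢node {w} {z} w≢u eq with z Fin.≟ u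
    ... | yes _   = contradiction (sym (nodes≢nodes eq)) w≢u
    ... | no  z≢u = nodes≢edges (universal z≢u) (sym eq)

    -- Away from `u`, a new node label is the `φ`-label of an edge at `u`, and a rim edge does not
    -- meet `u`.
    rim≢node : ∀ {x y z} → x ~ y → x ≢ u → y ≢ u → complementLabel z ≢ ∣ label φ x - label φ y ∣
    rim≢node {z = z} x~y x≢u y≢u eq with z Fin.≟ u
    ... | yes _   = nodes≢edges x~y eq
    ... | no  z≢u with edges≢edges (universal z≢u) x~y eq
    ...   | inj₁ (u≡x , _) = x≢u (sym u≡x)
    ...   | inj₂ (u≡y , _) = y≢u (sym u≡y)

    complement-nodes≢edges : ∀ {x y z} → x ~ y → complementLabel z ≢ difference x y
    complement-nodes≢edges {z = z} x~y eq with edgeLabel x~y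
    ... | spokeˡ refl d   = spoke≢node {z = z} (≢-sym (~⇒≢ x~y)) (trans eq d)
    ... | spokeʳ refl d   = spoke≢node {z = z} (~⇒≢ x~y) (trans eq d)
    ... | rim x≢u y≢u d   = rim≢node {z = z} x~y x≢u y≢u (trans eq d)

    complement-distinct : Distinct G complement
    complement-distinct = record
      { nodes≢nodes = complement-injective
      ; edges≢edges = complement-edges
      ; nodes≢edges = λ {_} {_} {z} → complement-nodes≢edges {z = z}
      }

    -- Transfers the range bound on the labels from `φ` to `complement`, with the same excess.
    complement-labels : (N complement ∪ E G complement) ⊆ (N φ ∪ E G φ)
    complement-labels (inj₁ (z , eq)) with z Fin.≟ u
    ... | yes _   = inj₁ (u , eq)
    ... | no  z≢u = inj₂ (u , z , universal z≢u , eq)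
    complement-labels (inj₂ (x , y , x~y , eq)) with edgeLabel x~y
    ... | spokeˡ _ d  = inj₁ (y , trans (sym d) eq)
    ... | spokeʳ _ d  = inj₁ (x , trans (sym d) eq)
    ... | rim _ _ d   = inj₂ (x , y , x~y , trans (sym d) eq)

  IsLeastExcess-unique : ∀ {k l} → IsLeastExcess G k → IsLeastExcess G l → k ≡ l
  IsLeastExcess-unique K L = ≤-antisym (K.least _ L.pos L.attained) (L.least _ K.pos K.attained)
    where
    module K = IsLeastExcess K
    module L = IsLeastExcess L

  opt-maximal : ∀ {opt φ} → IsOpt G opt → IsSemitotal G φ → ∀ x → label φ x ≤ opt
  opt-maximal (_ , least , refl) (_ , least′ , _ , fits) x
    -- `IsOpt` and `IsSemitotal` each bring their own least excess; the two must be identified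
    -- before the bound applies.
    rewrite IsLeastExcess-unique least least′ = proj₂ (fits (inj₁ (x , refl)))

theorem8p2 : ∀ {p : ℕ} (G : Graph p) → ¬ Supergraceful G →
    (u : Fin p) → Graph.degree G u ≡ p ∸ 1 →
    (opt : ℕ) → IsOpt G opt →
    (φ : Labeling p) → IsSemitotal G φ →
    label φ u ≡ opt → opt ∸ 1 ∈ (N φ ∪ E G φ) →
    ∃[ μ ] IsSemitotal G μ × 1 ∈ N μ
theorem8p2 G _ u deg _ isOpt φ semi@(q₀ , least , distinct , fits) refl (inj₁ (x , φx≡opt∸1)) =
  complement , (q₀ , least , complement-distinct , fits ∘ complement-labels) , x , (begin
    complementLabel x                 ≡⟨ complement-other x≢u ⟩
    ∣ label φ u - label φ x ∣         ≡⟨ cong ∣ label φ u -_∣ φx≡opt∸1 ⟩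
    ∣ label φ u - label φ u ∸ 1 ∣     ≡⟨ m≤n⇒∣n-m∣≡n∸m (m∸n≤m (label φ u) 1) ⟩
    label φ u ∸ (label φ u ∸ 1)       ≡⟨ m∸[m∸n]≡n (positive φ u) ⟩
    1                                 ∎)
  where
  open ≡-Reasoning
  open Complement G φ distinct u (degree≡p∸1⇒universal G u deg) (opt-maximal G isOpt semi)
  x≢u : x ≢ u
  -- If `x` were `u`, then `label φ u ∸ 1` would equal `label φ u`, which positivity excludes.
  x≢u refl = <⇒≢ (∸-monoʳ-< (s≤s z≤n) (positive φ u)) (sym φx≡opt∸1)
theorem8p2 G _ u _ _ isOpt φ semi refl (inj₂ (x , y , _ , eq))
  with extreme-difference (positive φ x) (positive φ y)
         (opt-maximal G isOpt semi x) (opt-maximal G isOpt semi y) eq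
... | inj₁ φx≡1 = φ , semi , x , φx≡1
... | inj₂ φy≡1 = φ , semi , y , φy≡1
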